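{- For every integer $m\ge2$ and every graph $G$, $\hom(S_{2,1^{m-2}};G)^{m}\ge \hom(S_{2,1^{m-1}};G)^{m-1}$. (For $m=2$ this is the path inequality $\hom(P_2;G)^2\ge\hom(P_3;G)$, where $P_\ell$ is the path with $\ell$ edges.)
   Context: All graphs are finite; $\hom(H;G)$ is the number of graph homomorphisms from $H$ to $G$. For $k\ge0$, $S_{2,1^k}$ is the tree with vertex set $\{1,\ldots,k+3\}$ and edge set $\{\{1,j\}:2\le j\le k+2\}\cup\{\{k+2,k+3\}\}$; note $S_{2,1^0}=P_2$ and $S_{2,1^1}=P_3$. -}

module Defs where

open import Data.Fin using (Fin; toℕ)
open import Data.Fin.Properties using (all?)
open import Data.List using (List; []; _∷_; allFin; cartesianProductWith; filter; length)
open import Data.List.Membership.Propositional using (_∈_)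
open import Data.List.Membership.Propositional.Properties using (∈-allFin; ∈-cartesianProductWith⁺)
open import Data.List.Relation.Unary.All using ([])
open import Data.List.Relation.Unary.AllPairs using ([]; _∷_)
open import Data.List.Relation.Unary.Any using (here)
open import Data.List.Relation.Unary.Unique.Propositional using (Unique)
open import Data.List.Relation.Unary.Unique.Propositional.Properties using (allFin⁺; cartesianProductWith⁺)
open import Data.Nat using (ℕ; zero; suc; _+_; _≤_; s≤s; _≟_; _≤?_)
open import Data.Nat.Properties using (+-cancelˡ-≡)
open import Data.Product using (_×_; _,_)
open import Data.Sum using (_⊎_; inj₁; inj₂; swap)
open import Data.Vec as Vec using (Vec; lookup)
open import Data.Vec.Properties using (∷-injective)
open import Level using (0ℓ)
open import Relation.Binary using (Rel; Symmetric; Irreflexive; Decidable)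
open import Relation.Binary.PropositionalEquality using (_≡_; refl; sym; trans)
open import Relation.Nullary using (Dec; ¬_)
open import Relation.Nullary.Decidable using (_×-dec_; _⊎-dec_; _→-dec_)

-- A finite simple graph, with vertex set Fin order (possibly empty).
record Graph : Set₁ where
  field
    order  : ℕ
    Adj    : Rel (Fin order) 0ℓ
    adj?   : Decidable Adj
    symm   : Symmetric Adj
    irrefl : Irreflexive _≡_ Adj

open Graph public

IsHom : (H G : Graph) → (Fin (order H) → Fin (order G)) → Set
IsHom H G f = ∀ u v → Adj H u v → Adj G (f u) (f v)

isHom? : ∀ H G f → Dec (IsHom H G f)
isHom? H G f = all? λ u → all? λ v → adj? H u v →-dec adj? G (f u) (f v)

-- All maps Fin k → Fin n, each represented by its vector of values, so that
-- counting needs no function extensionality.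
maps : (k n : ℕ) → List (Vec (Fin n) k)
maps zero    n = Vec.[] ∷ []
maps (suc k) n = cartesianProductWith Vec._∷_ (allFin n) (maps k n)

maps-complete : ∀ {k n} (f : Vec (Fin n) k) → f ∈ maps k n
maps-complete Vec.[]      = here refl
maps-complete (x Vec.∷ f) = ∈-cartesianProductWith⁺ Vec._∷_ (∈-allFin x) (maps-complete f)

maps-unique : ∀ k n → Unique (maps k n)
maps-unique zero    n = [] ∷ []
maps-unique (suc k) n = cartesianProductWith⁺ Vec._∷_ ∷-injective (allFin⁺ n) (maps-unique k n)

hom : Graph → Graph → ℕ
hom H G = length (filter (λ f → isHom? H G (lookup f)) (maps (order H) (order G)))

-- The edges {a , b} of S_{2,1^k}, oriented so that a < b, on the vertex
-- labels 1, …, k + 3.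
SEdge : ℕ → ℕ → ℕ → Set
SEdge k a b = (a ≡ 1 × 2 ≤ b × b ≤ k + 2) ⊎ (a ≡ k + 2 × b ≡ k + 3)

sEdge? : ∀ k a b → Dec (SEdge k a b)
sEdge? k a b = ((a ≟ 1) ×-dec ((2 ≤? b) ×-dec (b ≤? k + 2))) ⊎-dec ((a ≟ k + 2) ×-dec (b ≟ k + 3))

sEdge-irrefl : ∀ k a → ¬ SEdge k a a
sEdge-irrefl k a (inj₁ (refl , s≤s () , _))
sEdge-irrefl k a (inj₂ (p , q)) with +-cancelˡ-≡ k 2 3 (trans (sym p) q)
... | ()

label : ∀ {n} → Fin n → ℕ
label i = suc (toℕ i)

-- The tree S_{2,1^k}.
S₂₁ : ℕ → Graph
S₂₁ k = record
  { order  = 3 + k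
  ; Adj    = λ i j → SEdge k (label i) (label j) ⊎ SEdge k (label j) (label i)
  ; adj?   = λ i j → sEdge? k (label i) (label j) ⊎-dec sEdge? k (label j) (label i)
  ; symm   = swap
  ; irrefl = λ { {i} refl (inj₁ e) → sEdge-irrefl k (label i) e
               ; {i} refl (inj₂ e) → sEdge-irrefl k (label i) e }
  }

{-# OPTIONS --safe #-}

-- Let d v be the degree of v, s v the sum of the degrees of the neighbours of v,
-- and Δ the maximum degree. Mapping the centre of the tree first gives
-- hom (S₂₁ k) G = Aₖ := Σᵥ d(v)ᵏ s(v), so that Aₖ₊₁ ≤ Δ Aₖ. Since s ≥ d pointwise,
-- a vertex of degree Δ contributes at least Δᵏ⁺¹ to Aₖ. Hence
-- Aₖ₊₁ᵏ⁺¹ ≤ Δᵏ⁺¹ Aₖᵏ⁺¹ ≤ Aₖᵏ⁺².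
module Submission where

open import Defs
import Algebra.Properties.Semiring.Sum
open import Data.Bool using (if_then_else_)
open import Data.Fin using (Fin; zero; suc; toℕ)
open import Data.List using (List; []; _∷_; _++_; allFin; cartesianProductWith; filter; length; map; tabulate)
open import Data.List.Extrema.Nat using (max; xs≤max; argmax-all)
open import Data.List.Membership.Propositional.Properties using (∈-map⁺; ∈-allFin)
open import Data.List.Properties using (length-++; filter-++; filter-none)
open import Data.List.Relation.Unary.All as All using ()
open import Data.List.Relation.Unary.All.Properties using (map⁺)
open import Data.Nat using (ℕ; zero; suc; _+_; _*_; _^_; _∸_; _≤_; _≥_; z≤n; s≤s; s≤s⁻¹)
open import Data.Nat.Properties
open import Data.Product using (_×_; _,_; proj₁; proj₂)
open import Data.Sum using (inj₁; inj₂)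
open import Data.Vec as Vec using (Vec; lookup)
open import Function using (_∘_; id)
open import Relation.Binary.PropositionalEquality using (_≡_; refl; sym; trans; cong; cong₂; subst; module ≡-Reasoning)
open import Relation.Nullary using (Dec; does; yes; no; contradiction)
open import Relation.Nullary.Decidable using (_×-dec_)
open import Relation.Unary using (Decidable)

open Algebra.Properties.Semiring.Sum +-*-semiring using (sum; sum-cong-≗; *-distribˡ-sum; *-distribʳ-sum)

-- Powers and finite sums of natural numbers.

^-distribʳ-* : ∀ m n o → (m * n) ^ o ≡ m ^ o * n ^ o
^-distribʳ-* m n zero    = refl
^-distribʳ-* m n (suc o) =
  trans (cong (m * n *_) (^-distribʳ-* m n o)) ([m*n]*[o*p]≡[m*o]*[n*p] m n (m ^ o) (n ^ o))

sum-mono-≤ : ∀ {n} {f g : Fin n → ℕ} → (∀ i → f i ≤ g i) → sum f ≤ sum g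
sum-mono-≤ {zero}  f≤g = z≤n
sum-mono-≤ {suc n} f≤g = +-mono-≤ (f≤g zero) (sum-mono-≤ (f≤g ∘ suc))

term≤sum : ∀ {n} (f : Fin n → ℕ) i → f i ≤ sum f
term≤sum f zero    = m≤m+n _ _
term≤sum f (suc i) = ≤-trans (term≤sum (f ∘ suc) i) (m≤n+m _ _)

-- Counting list entries that satisfy a decidable predicate.

indicator : ∀ {P : Set} → Dec P → ℕ
indicator d = if does d then 1 else 0

module _ {A : Set} where

  count : {P : A → Set} → Decidable P → List A → ℕ
  count P? xs = length (filter P? xs)

  count-cong : ∀ {P Q : A → Set} (P? : Decidable P) (Q? : Decidable Q) →
               (∀ x → P x → Q x) → (∀ x → Q x → P x) → ∀ xs → count P? xs ≡ count Q? xs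
  count-cong P? Q? P⊆Q Q⊆P [] = refl
  count-cong P? Q? P⊆Q Q⊆P (x ∷ xs) with P? x | Q? x
  ... | yes p | yes q = cong suc (count-cong P? Q? P⊆Q Q⊆P xs)
  ... | no ¬p | no ¬q = count-cong P? Q? P⊆Q Q⊆P xs
  ... | yes p | no ¬q = contradiction (P⊆Q x p) ¬q
  ... | no ¬p | yes q = contradiction (Q⊆P x q) ¬p

  -- The condition `d` does not mention the list entry, so it keeps or discards the whole list at
  -- once.
  count-× : ∀ {D : Set} {Q : A → Set} (d : Dec D) (Q? : Decidable Q) xs →
            count (λ x → d ×-dec Q? x) xs ≡ indicator d * count Q? xs
  count-× (yes p) Q? xs =
    trans (count-cong (λ x → yes p ×-dec Q? x) Q? (λ _ → proj₂) (λ _ → p ,_) xs) (sym (+-identityʳ _))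
  count-× (no ¬p) Q? xs =
    cong length (filter-none (λ x → no ¬p ×-dec Q? x) (All.universal (λ _ → ¬p ∘ proj₁) xs))

count-map : ∀ {A B : Set} {P : B → Set} (P? : Decidable P) (f : A → B) xs →
            count P? (map f xs) ≡ count (P? ∘ f) xs
count-map P? f [] = refl
count-map P? f (x ∷ xs) with P? (f x)
... | yes _ = cong suc (count-map P? f xs)
... | no _  = count-map P? f xs

-- A general `tabulate g` lets the induction pass to `g ∘ suc`; `allFin n` is the case where `g` is
-- `id`.
count-cartesianProductWith :
  ∀ {A B C : Set} {P : C → Set} (P? : Decidable P) (f : A → B → C) {n} (g : Fin n → A) ys →
  count P? (cartesianProductWith f (tabulate g) ys) ≡ sum (λ i → count (P? ∘ f (g i)) ys)
count-cartesianProductWith P? f {zero}  g ys = refl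
count-cartesianProductWith P? f {suc n} g ys = begin
  count P? (map (f (g zero)) ys ++ rest)           ≡⟨ cong length (filter-++ P? (map (f (g zero)) ys) rest) ⟩
  length (filter P? (map (f (g zero)) ys) ++ filter P? rest) ≡⟨ length-++ (filter P? (map (f (g zero)) ys)) ⟩
  count P? (map (f (g zero)) ys) + count P? rest   ≡⟨ cong₂ _+_ (count-map P? (f (g zero)) ys)
                                                        (count-cartesianProductWith P? f (g ∘ suc) ys) ⟩
  sum (λ i → count (P? ∘ f (g i)) ys)              ∎
  where
  open ≡-Reasoning
  rest = cartesianProductWith f (tabulate (g ∘ suc)) ys

count-maps-suc : ∀ {k n} {P : Vec (Fin n) (suc k) → Set} (P? : Decidable P) →
                 count P? (maps (suc k) n) ≡ sum (λ x → count (P? ∘ (x Vec.∷_)) (maps k n))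
count-maps-suc {k} {n} P? = count-cartesianProductWith P? Vec._∷_ id (maps k n)

count-singleton : ∀ {A : Set} {P : A → Set} (P? : Decidable P) x → count P? (x ∷ []) ≡ indicator (P? x)
count-singleton P? x with P? x
... | yes _ = refl
... | no _  = refl

-- Counting homomorphisms from the tree.

module _ (G : Graph) where

  private
    V = Fin (order G)

  degree : V → ℕ
  degree v = sum (λ w → indicator (adj? G v w))

  -- Equivalently, the number of walks of length two that start at `v`.
  neighbourDegreeSum : V → ℕ
  neighbourDegreeSum v = sum (λ w → indicator (adj? G v w) * degree w)

  -- The vector lists the images of the vertices 2, …, k + 3, and c is the image of 1.
  Extends : ∀ k → V → Vec V (2 + k) → Set
  Extends zero    c (x Vec.∷ xs) = Adj G c x × Adj G x (Vec.head xs)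
  Extends (suc k) c (x Vec.∷ xs) = Adj G c x × Extends k c xs

  extends? : ∀ k c → Decidable (Extends k c)
  extends? zero    c (x Vec.∷ xs) = adj? G c x ×-dec adj? G x (Vec.head xs)
  extends? (suc k) c (x Vec.∷ xs) = adj? G c x ×-dec extends? k c xs

  -- Position `i` of `xs` is the image of the vertex labelled `i + 2`, so the centre is joined to
  -- positions 0 to `k` and the pendant edge joins positions `k` and `k + 1`. The recursive form of
  -- `Extends` suits counting; this edgewise form matches `SEdge`.
  extends⁺ : ∀ k c (xs : Vec V (2 + k)) →
             (∀ i → toℕ i ≤ k → Adj G c (lookup xs i)) →
             (∀ i j → toℕ i ≡ k → toℕ j ≡ suc k → Adj G (lookup xs i) (lookup xs j)) →
             Extends k c xs
  extends⁺ zero c (x Vec.∷ y Vec.∷ Vec.[]) star pendant =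
    star zero z≤n , pendant zero (suc zero) refl refl
  extends⁺ (suc k) c (x Vec.∷ xs) star pendant =
    star zero z≤n ,
    extends⁺ k c xs (λ i i≤k → star (suc i) (s≤s i≤k))
      (λ i j i≡k j≡1+k → pendant (suc i) (suc j) (cong suc i≡k) (cong suc j≡1+k))

  extends-star : ∀ k c xs → Extends k c xs → ∀ i → toℕ i ≤ k → Adj G c (lookup xs i)
  extends-star zero    c (x Vec.∷ xs) (c~x , _)  zero    _         = c~x
  extends-star (suc k) c (x Vec.∷ xs) (c~x , _)  zero    _         = c~x
  extends-star (suc k) c (x Vec.∷ xs) (_ , rest) (suc i) (s≤s i≤k) = extends-star k c xs rest i i≤k

  extends-pendant : ∀ k c xs → Extends k c xs →
                    ∀ i j → toℕ i ≡ k → toℕ j ≡ suc k → Adj G (lookup xs i) (lookup xs j)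
  extends-pendant zero c (x Vec.∷ y Vec.∷ Vec.[]) (_ , x~y) zero (suc zero) _ _ = x~y
  extends-pendant (suc k) c (x Vec.∷ xs) (_ , rest) (suc i) (suc j) i≡k j≡1+k =
    extends-pendant k c xs rest i j (suc-injective i≡k) (suc-injective j≡1+k)

  isHom⇒extends : ∀ k c xs → IsHom (S₂₁ k) G (lookup (c Vec.∷ xs)) → Extends k c xs
  isHom⇒extends k c xs h = extends⁺ k c xs
    -- The label of `suc i` computes to `2 + toℕ i`, while `SEdge` writes `k + 2` and `k + 3`;
    -- commutativity bridges the two.
    (λ i i≤k → h zero (suc i)
      (inj₁ (inj₁ (refl , s≤s (s≤s z≤n) , subst (2 + toℕ i ≤_) (+-comm 2 k) (s≤s (s≤s i≤k))))))
    (λ i j i≡k j≡1+k → h (suc i) (suc j)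
      (inj₁ (inj₂ (trans (cong (2 +_) i≡k) (+-comm 2 k) , trans (cong (2 +_) j≡1+k) (+-comm 3 k)))))

  extends⇒isHom : ∀ k c xs → Extends k c xs → IsHom (S₂₁ k) G (lookup (c Vec.∷ xs))
  -- Adjacency in the tree is the symmetric closure of `SEdge`, so by symmetry of `G` only oriented
  -- edges need checking.
  extends⇒isHom k c xs ext = λ { u v (inj₁ e) → oriented u v e
                               ; u v (inj₂ e) → symm G (oriented v u e) }
    where
    oriented : ∀ u v → SEdge k (label u) (label v) →
               Adj G (lookup (c Vec.∷ xs) u) (lookup (c Vec.∷ xs) v)
    oriented zero zero (inj₁ (_ , s≤s () , _))
    oriented zero (suc j) (inj₁ (_ , _ , j≤)) =
      extends-star k c xs ext j (s≤s⁻¹ (s≤s⁻¹ (subst (2 + toℕ j ≤_) (+-comm k 2) j≤)))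
    oriented (suc i) v (inj₁ (() , _))
    -- The pendant edge avoids the centre: the label 1 is neither `k + 2` nor `k + 3`.
    oriented zero v (inj₂ (1≡ , _)) with trans 1≡ (+-comm k 2)
    ... | ()
    oriented (suc i) zero (inj₂ (_ , 1≡)) with trans 1≡ (+-comm k 3)
    ... | ()
    oriented (suc i) (suc j) (inj₂ (i≡ , j≡)) =
      extends-pendant k c xs ext i j
        (suc-injective (suc-injective (trans i≡ (+-comm k 2))))
        (suc-injective (suc-injective (trans j≡ (+-comm k 3))))

  count-adj-head : ∀ x → count (λ xs → adj? G x (Vec.head xs)) (maps 1 (order G)) ≡ degree x
  count-adj-head x = trans (count-maps-suc (λ xs → adj? G x (Vec.head xs)))
    (sum-cong-≗ λ y → count-singleton (λ _ → adj? G x y) Vec.[])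

  -- Once the centre is sent to `c`, each of the `k` leaves at it ranges independently over the
  -- neighbours of `c`. The remaining two vertices trace a walk of length two from `c`.
  count-extends : ∀ k c → count (extends? k c) (maps (2 + k) (order G)) ≡ degree c ^ k * neighbourDegreeSum c
  count-extends zero c = begin
    count (extends? 0 c) (maps 2 (order G))
      ≡⟨ count-maps-suc (extends? 0 c) ⟩
    sum (λ x → count (extends? 0 c ∘ (x Vec.∷_)) (maps 1 (order G)))
      ≡⟨ sum-cong-≗ (λ x → trans (count-× (adj? G c x) (λ xs → adj? G x (Vec.head xs)) (maps 1 (order G)))
                                 (cong (indicator (adj? G c x) *_) (count-adj-head x))) ⟩
    neighbourDegreeSum c
      ≡⟨ +-identityʳ _ ⟨
    degree c ^ 0 * neighbourDegreeSum c ∎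
    where open ≡-Reasoning
  count-extends (suc k) c = begin
    count (extends? (suc k) c) (maps (3 + k) (order G))
      ≡⟨ count-maps-suc (extends? (suc k) c) ⟩
    sum (λ x → count (extends? (suc k) c ∘ (x Vec.∷_)) (maps (2 + k) (order G)))
      ≡⟨ sum-cong-≗ (λ x → count-× (adj? G c x) (extends? k c) (maps (2 + k) (order G))) ⟩
    sum (λ x → indicator (adj? G c x) * N)
      ≡⟨ *-distribʳ-sum N (λ x → indicator (adj? G c x)) ⟨
    degree c * N
      ≡⟨ cong (degree c *_) (count-extends k c) ⟩
    degree c * (degree c ^ k * neighbourDegreeSum c)
      ≡⟨ *-assoc (degree c) _ _ ⟨
    degree c ^ suc k * neighbourDegreeSum c ∎
    where
    open ≡-Reasoning
    N = count (extends? k c) (maps (2 + k) (order G))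

  -- The centre is the first entry of the vector of values, so splitting off that entry sums over
  -- its image.
  hom-S₂₁ : ∀ k → hom (S₂₁ k) G ≡ sum (λ v → degree v ^ k * neighbourDegreeSum v)
  hom-S₂₁ k = trans (count-maps-suc (λ f → isHom? (S₂₁ k) G (lookup f)))
    (sum-cong-≗ λ c → trans
      (count-cong (λ xs → isHom? (S₂₁ k) G (lookup (c Vec.∷ xs))) (extends? k c)
        (isHom⇒extends k c) (extends⇒isHom k c) (maps (2 + k) (order G)))
      (count-extends k c))

  -- Bounds through the maximum degree.

  degree≤neighbourDegreeSum : ∀ v → degree v ≤ neighbourDegreeSum v
  degree≤neighbourDegreeSum v = sum-mono-≤ bound
    where
    -- By symmetry `v` is itself a neighbour of `w`.
    neighbour-degree>0 : ∀ w → Adj G v w → 1 ≤ degree w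
    neighbour-degree>0 w v~w = ≤-trans positive (term≤sum (λ u → indicator (adj? G w u)) v)
      where
      positive : 1 ≤ indicator (adj? G w v)
      positive with adj? G w v
      ... | yes _   = ≤-refl
      ... | no ¬w~v = contradiction (symm G v~w) ¬w~v

    bound : ∀ w → indicator (adj? G v w) ≤ indicator (adj? G v w) * degree w
    bound w with adj? G v w
    ... | yes v~w = ≤-trans (neighbour-degree>0 w v~w) (m≤m+n _ 0)
    ... | no _    = z≤n

  -- The default 0 covers the empty graph and leaves the maximum unchanged otherwise.
  maxDegree : ℕ
  maxDegree = max 0 (map degree (allFin (order G)))

  degree≤maxDegree : ∀ v → degree v ≤ maxDegree
  degree≤maxDegree v = All.lookup (xs≤max 0 (map degree (allFin (order G)))) (∈-map⁺ degree (∈-allFin v))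

  maxDegree^-≤-hom : ∀ k → maxDegree ^ suc k ≤ hom (S₂₁ k) G
  -- A property of the default and of every degree passes to the maximum, so no maximising vertex
  -- has to be chosen. At the default, `z≤n` suffices because the exponent is positive.
  maxDegree^-≤-hom k = argmax-all id {P = λ d → d ^ suc k ≤ hom (S₂₁ k) G} z≤n
    (map⁺ (All.universal degree^-≤-hom (allFin (order G))))
    where
    open ≤-Reasoning
    degree^-≤-hom : ∀ v → degree v ^ suc k ≤ hom (S₂₁ k) G
    degree^-≤-hom v = begin
      degree v * degree v ^ k                          ≡⟨ *-comm (degree v) _ ⟩
      degree v ^ k * degree v                          ≤⟨ *-monoʳ-≤ (degree v ^ k) (degree≤neighbourDegreeSum v) ⟩
      degree v ^ k * neighbourDegreeSum v              ≤⟨ term≤sum (λ w → degree w ^ k * neighbourDegreeSum w) v ⟩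
      sum (λ w → degree w ^ k * neighbourDegreeSum w)  ≡⟨ hom-S₂₁ k ⟨
      hom (S₂₁ k) G                                    ∎

  -- One more leaf multiplies the summand at `v` by `degree v`.
  hom-suc-≤ : ∀ k → hom (S₂₁ (suc k)) G ≤ maxDegree * hom (S₂₁ k) G
  hom-suc-≤ k = begin
    hom (S₂₁ (suc k)) G                              ≡⟨ hom-S₂₁ (suc k) ⟩
    sum (λ v → degree v ^ suc k * neighbourDegreeSum v)
      ≤⟨ sum-mono-≤ (λ v → ≤-trans (≤-reflexive (*-assoc (degree v) _ _))
                                   (*-monoˡ-≤ (term v) (degree≤maxDegree v))) ⟩
    sum (λ v → maxDegree * term v)                   ≡⟨ *-distribˡ-sum maxDegree term ⟨
    maxDegree * sum term                             ≡⟨ cong (maxDegree *_) (hom-S₂₁ k) ⟨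
    maxDegree * hom (S₂₁ k) G                        ∎
    where
    open ≤-Reasoning
    term : V → ℕ
    term v = degree v ^ k * neighbourDegreeSum v

theorem3p5 : (m : ℕ) → 2 ≤ m → (G : Graph) → hom (S₂₁ (m ∸ 2)) G ^ m ≥ hom (S₂₁ (m ∸ 1)) G ^ (m ∸ 1)
theorem3p5 (suc zero) (s≤s ())
-- With `m` equal to `k + 2`, both truncated subtractions compute, to `k` and `suc k`.
theorem3p5 (suc (suc k)) _ G = begin
  hom (S₂₁ (suc k)) G ^ suc k      ≤⟨ ^-monoˡ-≤ (suc k) (hom-suc-≤ G k) ⟩
  (Δ * A) ^ suc k                  ≡⟨ ^-distribʳ-* Δ A (suc k) ⟩
  -- The whole power of `Δ` is absorbed into a single factor `A`, which raises the exponent to `m`.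
  Δ ^ suc k * A ^ suc k            ≤⟨ *-monoˡ-≤ (A ^ suc k) (maxDegree^-≤-hom G k) ⟩
  A * A ^ suc k                    ∎
  where
  open ≤-Reasoning
  Δ = maxDegree G
  A = hom (S₂₁ k) G
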